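{- In the message-passing model with $k$ sites holding subgraphs of an undirected graph $G$ on $n$ vertices (edge duplication allowed), there is a randomized protocol that, with probability at least $0.99$, outputs a value $\tilde D$ with $D\le\tilde D\le D+2$, where $D$ is the diameter of $G$ (the maximum over pairs of vertices of their shortest-path distance), and that uses $O(kn^{3/2}\log^2 n)$ bits of communication.
   Context: Message-passing model: $k$ sites $P_1,\dots,P_k$, each holding a private input; two-way point-to-point channels between every pair of sites; at the end some site outputs the answer; cost is total bits exchanged. Graph setting: each site $P_i$ holds a subgraph $G_i\subseteq G$ on the common vertex set, and $G$ is the union of the $G_i$; "edge duplication allowed" means an edge may be held by several sites. Logarithms are base 2. -}

module Defs where

open import Data.Bool using (Bool; true; false; T)
open import Data.Fin using (Fin)
open import Data.List using (List; []; _∷_; length; filter; cartesianProductWith)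
open import Data.List.NonEmpty as List⁺ using (List⁺)
open import Data.Nat using (ℕ; zero; suc; _+_; _*_; _^_; _≤_)
open import Data.Nat.Logarithm using (⌊log₂_⌋)
open import Data.Product using (Σ-syntax; ∃; ∃₂; _×_)
open import Data.Vec using (Vec; []; _∷_; lookup)
open import Data.Vec.Functional using (Vector; updateAt)
open import Function using (_⇔_)
open import Relation.Binary.PropositionalEquality using (_≡_; _≢_)
open import Relation.Nullary using (¬_)
open import Relation.Nullary.Construct.Add.Supremum using (_⁺; [_]; ⊤⁺)
open import Relation.Unary using (Pred; Decidable)
import Relation.Binary.Construct.Add.Supremum.NonStrict as Supremum
open import Level using (0ℓ)

record Graph (n : ℕ) : Set where
  field
    adj    : Fin n → Fin n → Bool
    sym    : ∀ u v → adj u v ≡ adj v u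
    irrefl : ∀ u → adj u u ≡ false

  Edge : Fin n → Fin n → Set
  Edge u v = T (adj u v)

open Graph public using (Edge)

-- The parts need not be edge-disjoint: an edge may be held by several sites.
_IsUnionOf_ : ∀ {n k} → Graph n → Vector (Graph n) k → Set
G IsUnionOf Gs = ∀ u v → Edge G u v ⇔ ∃ λ i → Edge (Gs i) u v

-- Distances and diameters live in ℕ extended by ∞ = ⊤⁺, so that disconnected
-- graphs have diameter ∞.
ℕ∞ : Set
ℕ∞ = ℕ ⁺

open Supremum _≤_ public using () renaming (_≤⁺_ to _≤∞_)

_+∞_ : ℕ∞ → ℕ → ℕ∞
[ d ] +∞ m = [ d + m ]
⊤⁺    +∞ m = ⊤⁺

data Walk {n} (G : Graph n) : ℕ → Fin n → Fin n → Set where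
  nil  : ∀ {u} → Walk G 0 u u
  cons : ∀ {ℓ u v w} → Edge G u v → Walk G ℓ v w → Walk G (suc ℓ) u w

IsDistance : ∀ {n} → Graph n → Fin n → Fin n → ℕ∞ → Set
IsDistance G u v [ d ] = Walk G d u v × (∀ ℓ → Walk G ℓ u v → d ≤ ℓ)
IsDistance G u v ⊤⁺    = ∀ ℓ → ¬ Walk G ℓ u v

IsDiameter : ∀ {n} → Graph n → ℕ∞ → Set
IsDiameter G D =
  (∃₂ λ u v → IsDistance G u v D) ×
  (∀ u v d → IsDistance G u v d → d ≤∞ D)

-- Messages are nonempty, so no information travels for free in zero-length
-- messages.
Message : Set
Message = List⁺ Bool

data Event (k : ℕ) : Set where
  sent     : (to   : Fin k) → Message → Event k
  received : (from : Fin k) → Message → Event k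

-- A site's own view of the communication so far, most recent event first.
History : ℕ → Set
History k = List (Event k)

data Action {k : ℕ} (i : Fin k) (Out : Set) : Set where
  send   : (j : Fin k) → j ≢ i → Message → Action i Out
  output : Out → Action i Out

-- Exactly one site is active at any time: at first `start`, afterwards the
-- recipient of the latest message.  What the active site does depends only on
-- its own input, its own `coins` private random bits and its own history; in
-- particular neither a global clock nor other sites' traffic is visible to it.
record Protocol (k : ℕ) (In Out : Set) : Set where
  field
    coins    : ℕ
    start    : Fin k
    strategy : (i : Fin k) → In → Vec Bool coins → History k → Action i Out

  Randomness : Set
  Randomness = Vec (Vec Bool coins) k

module _ {k In Out} (P : Protocol k In Out) where
  open Protocol P

  module _ (x : Vector In k) (ω : Randomness) where

    deliver : Fin k → Fin k → Message → Vector (History k) k → Vector (History k) k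
    deliver i j m h =
      updateAt (updateAt h i (sent j m ∷_)) j (received i m ∷_)

    -- Run i h b o: with site i active and histories h, the execution halts
    -- with some site outputting o after b further bits of communication.
    data Run (i : Fin k) (h : Vector (History k) k) : ℕ → Out → Set where
      halts : ∀ {o} → strategy i (x i) (lookup ω i) (h i) ≡ output o →
              Run i h 0 o
      sends : ∀ {j j≢i m b o} →
              strategy i (x i) (lookup ω i) (h i) ≡ send j j≢i m →
              Run j (deliver i j m h) b o →
              Run i h (List⁺.length m + b) o

    Executes : ℕ → Out → Set
    Executes = Run start (λ _ → [])

vectors : {A : Set} → List A → (m : ℕ) → List (Vec A m)
vectors xs zero    = [] ∷ []
vectors xs (suc m) = cartesianProductWith _∷_ xs (vectors xs m)

-- Every value of the sites' joint randomness, each listed exactly once.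
sampleSpace : ∀ {k In Out} (P : Protocol k In Out) → List (Protocol.Randomness P)
sampleSpace {k} P = vectors (vectors (true ∷ false ∷ []) (Protocol.coins P)) k

-- The event E has probability at least p / q under uniform, independent
-- private coins.
ProbAtLeast : ∀ {k In Out} (P : Protocol k In Out) (p q : ℕ) →
              Pred (Protocol.Randomness P) 0ℓ → Set
ProbAtLeast P p q E =
  Σ[ E? ∈ Decidable E ]
    p * length (sampleSpace P) ≤ q * length (filter E? (sampleSpace P))

-- b ≤ C · k · n^(3/2) · ⌊log₂ n⌋², squared to stay within ℕ.  The floor only
-- makes the bound stricter than the one with log₂ n.
CostBound : (C k n b : ℕ) → Set
CostBound C k n b = b ^ 2 ≤ (C * k * ⌊log₂ n ⌋ ^ 2) ^ 2 * n ^ 3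

{-# OPTIONS --safe #-}

-- A deterministic protocol.  Process the vertices v in turn and ask for the
-- neighbours S of v among the still unclustered vertices.  If |S| ≥ s ≈ √n, then
-- v becomes a centre and S is clustered; this happens at most n / s times.
-- Otherwise S is short and is remembered.  In the end all edges that meet an
-- unclustered vertex are known.  Breadth-first search from every centre then
-- gives the exact distances to the centres.  Estimate the distance of u and v by
-- the smaller of their distance in the known graph and the least sum of their
-- distances to a common centre.  A shortest path either consists of known edges
-- or contains a clustered vertex, from which the detour to its centre and back
-- costs 2.
module Submission where

open import Defs
open import Data.Bool using (Bool; true; false; T; T?; if_then_else_)
import Data.Bool.Properties as Bool
open import Data.Empty using (⊥-elim)
open import Data.Fin as Fin using (Fin; zero; suc; toℕ; fromℕ; inject₁; inject≤; finToFun; funToFin)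
import Data.Fin.Induction as Fin
import Data.Fin.Properties as Fin
open import Data.Fin.Subset
open import Data.Fin.Subset.Properties
open import Data.List as List using (List; []; _∷_)
import Data.List.Extrema
open import Data.List.Membership.Propositional using (lose) renaming (_∈_ to _∈ˡ_)
open import Data.List.Membership.Propositional.Properties using (∈-allFin; ∈-cartesianProduct⁺; ∈-map⁺)
open import Data.List.NonEmpty as List⁺ using (List⁺; _∷_)
import Data.List.Properties as List
import Data.List.Relation.Unary.All as All
import Data.List.Relation.Unary.All.Properties as All
open import Data.List.Relation.Unary.Any as Any using (Any)
open import Data.Maybe using (Maybe; just; nothing)
open import Data.Nat
open import Data.Nat.Induction using (<-rec)
open import Data.Nat.Logarithm
open import Data.Nat.Properties
open import Data.Nat.Tactic.RingSolver using (solve-∀)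
open import Data.Product as Product
open import Data.Sum as Sum using (_⊎_; inj₁; inj₂)
open import Data.Vec as Vec using (Vec; []; _∷_)
import Data.Vec.Properties as Vec
open import Data.Vec.Functional using (Vector; updateAt)
open import Data.Vec.Functional.Properties using (updateAt-updates; updateAt-minimal)
open import Function
open import Function.Properties.Inverse using (Inverse⇒Injection)
open import Relation.Binary.Bundles using (TotalOrder)
open import Relation.Binary.Construct.Add.Supremum.NonStrict _≤_ using (≤⁺-isTotalOrder-≡; ≤⁺-trans; _≤⊤⁺; [_])
open import Relation.Binary.PropositionalEquality
open import Relation.Nullary
open import Relation.Nullary.Construct.Add.Supremum using ([_]; ⊤⁺)
open import Relation.Nullary.Decidable using (dec-true; dec-false; does-⇔; isYes≗does; toWitness)
open import Relation.Unary using (Pred; Decidable)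

private variable
  k m n ℓ : ℕ

-- Subsets of a finite set

module _ {p} {P : Pred (Fin n) p} (P? : Decidable P) where

  comprehension : Subset n
  comprehension = Vec.tabulate (λ v → does (P? v))

  ∈-comprehension⁺ : ∀ {v} → P v → v ∈ comprehension
  ∈-comprehension⁺ {v} Pv = Vec.lookup⇒[]= v comprehension
    (trans (Vec.lookup∘tabulate _ v) (dec-true (P? v) Pv))

  ∈-comprehension⁻ : ∀ {v} → v ∈ comprehension → P v
  ∈-comprehension⁻ {v} v∈ with P? v | trans (sym (Vec.lookup∘tabulate (λ v → does (P? v)) v)) (Vec.[]=⇒lookup v∈)
  ... | yes Pv | _ = Pv

∣p∩∁q∣+∣p∩q∣≡∣p∣ : (p q : Subset n) → ∣ p ∩ ∁ q ∣ + ∣ p ∩ q ∣ ≡ ∣ p ∣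
∣p∩∁q∣+∣p∩q∣≡∣p∣ []            []            = refl
∣p∩∁q∣+∣p∩q∣≡∣p∣ (outside ∷ p) (_       ∷ q) = ∣p∩∁q∣+∣p∩q∣≡∣p∣ p q
∣p∩∁q∣+∣p∩q∣≡∣p∣ (inside  ∷ p) (outside ∷ q) = cong suc (∣p∩∁q∣+∣p∩q∣≡∣p∣ p q)
∣p∩∁q∣+∣p∩q∣≡∣p∣ (inside  ∷ p) (inside  ∷ q) =
  trans (+-suc ∣ p ∩ ∁ q ∣ ∣ p ∩ q ∣) (cong suc (∣p∩∁q∣+∣p∩q∣≡∣p∣ p q))

∣p∩∁q∣+∣q∣≡∣p∣ : (p q : Subset n) → q ⊆ p → ∣ p ∩ ∁ q ∣ + ∣ q ∣ ≡ ∣ p ∣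
∣p∩∁q∣+∣q∣≡∣p∣ p q q⊆p =
  subst (λ r → ∣ p ∩ ∁ q ∣ + ∣ r ∣ ≡ ∣ p ∣) p∩q≡q (∣p∩∁q∣+∣p∩q∣≡∣p∣ p q)
  where
  p∩q≡q : p ∩ q ≡ q
  p∩q≡q = ⊆-antisym (p∩q⊆q p q) (λ x∈q → x∈p∩q⁺ (q⊆p x∈q , x∈q))

-- Encoding of vertex sets

strip : Vec Bool ℓ → List Bool → Maybe (List Bool)
strip []      bs       = just bs
strip (_ ∷ _) []       = nothing
strip (c ∷ cs) (b ∷ bs) with c Bool.≟ b
... | yes _ = strip cs bs
... | no  _ = nothing

strip-self : (c : Vec Bool ℓ) (bs : List Bool) → strip c (Vec.toList c List.++ bs) ≡ just bs
strip-self []       bs = refl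
strip-self (c ∷ cs) bs with c Bool.≟ c
... | yes _  = strip-self cs bs
... | no c≢c = contradiction refl c≢c

-- Both codes have the same length, so the comparison meets a differing bit before either of them
-- ends.
strip-other : (c d : Vec Bool ℓ) (bs : List Bool) → c ≢ d →
              strip c (Vec.toList d List.++ bs) ≡ nothing
strip-other []       []       bs c≢d = contradiction refl c≢d
strip-other (c ∷ cs) (d ∷ ds) bs c≢d with c Bool.≟ d
... | yes refl = strip-other cs ds bs (c≢d ∘ cong (c ∷_))
... | no  _    = refl

-- A set is written as the codes of its elements in increasing order; the code
-- that follows those of the vertices serves as end marker.
Code : ℕ → ℕ → Set
Code ℓ m = Fin (suc m) → Vec Bool ℓ

encodeSet : Code ℓ m → Subset m → List Bool
encodeSet c []            = Vec.toList (c zero)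
encodeSet c (inside  ∷ p) = Vec.toList (c zero) List.++ encodeSet (c ∘ suc) p
encodeSet c (outside ∷ p) = encodeSet (c ∘ suc) p

-- The undecoded rest is returned too, so that two sets written one after the other can be
-- separated.
decodeSet : Code ℓ m → List Bool → Subset m × List Bool
decodeSet {ℓ} {zero}  c bs = [] , List.drop ℓ bs
decodeSet {ℓ} {suc m} c bs with strip (c zero) bs
... | just bs′ = Product.map₁ (inside ∷_) (decodeSet (c ∘ suc) bs′)
... | nothing  = Product.map₁ (outside ∷_) (decodeSet (c ∘ suc) bs)

length-encodeSet : (c : Code ℓ m) (p : Subset m) →
                   List.length (encodeSet c p) ≡ (1 + ∣ p ∣) * ℓ
length-encodeSet {ℓ} c []            = trans (Vec.length-toList (c zero)) (sym (+-identityʳ ℓ))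
length-encodeSet c (inside  ∷ p) = trans
  (List.length-++ (Vec.toList (c zero)))
  (cong₂ _+_ (Vec.length-toList (c zero)) (length-encodeSet (c ∘ suc) p))
length-encodeSet c (outside ∷ p) = length-encodeSet (c ∘ suc) p

-- Needed when the first vertex is absent: the encoding then begins with the code of a later vertex
-- or with the end marker, and injectivity keeps `strip` from mistaking it for `c zero`.
encodeSet-head : (c : Code ℓ m) (p : Subset m) →
                 ∃₂ λ i bs → encodeSet c p ≡ Vec.toList (c i) List.++ bs
encodeSet-head c []            = zero , [] , sym (List.++-identityʳ _)
encodeSet-head c (inside  ∷ p) = zero , _ , refl
encodeSet-head c (outside ∷ p) = Product.map suc id (encodeSet-head (c ∘ suc) p)

drop-code : (c : Vec Bool ℓ) (bs : List Bool) → List.drop ℓ (Vec.toList c List.++ bs) ≡ bs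
drop-code []      bs = refl
drop-code (_ ∷ c) bs = drop-code c bs

decodeSet-encodeSet : (c : Code ℓ m) → Injective _≡_ _≡_ c → ∀ p bs →
                      decodeSet c (encodeSet c p List.++ bs) ≡ (p , bs)
decodeSet-encodeSet c inj [] bs = cong ([] ,_) (drop-code (c zero) bs)
decodeSet-encodeSet c inj (inside ∷ p) bs
  rewrite List.++-assoc (Vec.toList (c zero)) (encodeSet (c ∘ suc) p) bs
        | strip-self (c zero) (encodeSet (c ∘ suc) p List.++ bs)
  = cong (Product.map₁ (inside ∷_)) (decodeSet-encodeSet (c ∘ suc) (Fin.suc-injective ∘ inj) p bs)
decodeSet-encodeSet c inj (outside ∷ p) bs
  with i , bs′ , eq ← encodeSet-head (c ∘ suc) p
  rewrite trans (cong (λ xs → strip (c zero) (xs List.++ bs)) eq)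
            (trans (cong (strip (c zero)) (List.++-assoc (Vec.toList (c (suc i))) bs′ bs))
              (strip-other (c zero) (c (suc i)) (bs′ List.++ bs) (Fin.0≢1+n ∘ inj)))
  = cong (Product.map₁ (outside ∷_)) (decodeSet-encodeSet (c ∘ suc) (Fin.suc-injective ∘ inj) p bs)

-- Strong induction along `⌊ n /2⌋`, since halving lowers the logarithm by one. Strictness leaves
-- room for n + 1 codes: the n vertices and the end marker.
n<2^[1+⌊log₂n⌋] : ∀ n → n < 2 ^ suc ⌊log₂ n ⌋
n<2^[1+⌊log₂n⌋] = <-rec _ bound
  where
  bound : ∀ n → (∀ {m} → m < n → m < 2 ^ suc ⌊log₂ m ⌋) → n < 2 ^ suc ⌊log₂ n ⌋
  bound 0 _ = s≤s z≤n
  bound 1 _ = s≤s (s≤s z≤n)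
  bound n@(suc (suc _)) rec = begin-strict
    n                               ≡⟨ ⌊n/2⌋+⌈n/2⌉≡n n ⟨
    ⌊ n /2⌋ + ⌈ n /2⌉               ≤⟨ +-monoʳ-≤ ⌊ n /2⌋ (⌊n/2⌋-mono (n≤1+n (suc n))) ⟩
    ⌊ n /2⌋ + suc ⌊ n /2⌋           <⟨ +-mono-<-≤ half half ⟩
    2 ^ suc l + 2 ^ suc l           ≡⟨ cong (2 ^ suc l +_) (+-identityʳ (2 ^ suc l)) ⟨
    2 ^ suc (suc l)                 ≡⟨ cong (λ x → 2 ^ suc x) (suc-l) ⟩
    2 ^ suc ⌊log₂ n ⌋               ∎
    where
    open ≤-Reasoning
    l = ⌊log₂ ⌊ n /2⌋ ⌋
    half : ⌊ n /2⌋ < 2 ^ suc l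
    half = rec (⌊n/2⌋<n (suc _))
    suc-l : suc l ≡ ⌊log₂ n ⌋
    suc-l = trans (cong suc (⌊log₂⌊n/2⌋⌋≡⌊log₂n⌋∸1 n))
      (m+[n∸m]≡n (⌊log₂⌋-mono-≤ {2} {n} (s≤s (s≤s z≤n))))

binary : ∀ ℓ → Fin (2 ^ ℓ) → Vec Bool ℓ
binary ℓ i = Vec.tabulate (Inverse.to Fin.2↔Bool ∘ finToFun {2} {ℓ} i)

-- Replaces function extensionality: equal bit vectors only give pointwise equal digit functions.
funToFin-cong : {f g : Fin m → Fin n} → f ≗ g → funToFin f ≡ funToFin g
funToFin-cong {zero}  f≗g = refl
funToFin-cong {suc m} f≗g = cong₂ Fin.combine (f≗g zero) (funToFin-cong (f≗g ∘ suc))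

binary-injective : ∀ ℓ → Injective _≡_ _≡_ (binary ℓ)
binary-injective ℓ {i} {j} eq = begin
  i                                ≡⟨ Fin.funToFin-finToFin {ℓ} {2} i ⟨
  funToFin {ℓ} {2} (finToFun i)    ≡⟨ funToFin-cong same-digits ⟩
  funToFin {ℓ} {2} (finToFun j)    ≡⟨ Fin.funToFin-finToFin {ℓ} {2} j ⟩
  j                                ∎
  where
  open ≡-Reasoning
  same-digits : finToFun {2} {ℓ} i ≗ finToFun j
  same-digits d = Injection.injective (Inverse⇒Injection Fin.2↔Bool)
    (trans (sym (Vec.lookup∘tabulate (Inverse.to Fin.2↔Bool ∘ finToFun {2} {ℓ} i) d))
    (trans (cong (λ bs → Vec.lookup bs d) eq)
           (Vec.lookup∘tabulate (Inverse.to Fin.2↔Bool ∘ finToFun {2} {ℓ} j) d)))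

width : ℕ → ℕ
width n = suc ⌊log₂ n ⌋

code : ∀ n → Code (width n) n
code n v = binary (width n) (inject≤ v (n<2^[1+⌊log₂n⌋] n))

code-injective : ∀ n → Injective _≡_ _≡_ (code n)
code-injective n {u} {v} eq = Fin.inject≤-injective _ _ u v (binary-injective (width n) eq)

-- The leading bit carries no information; it supplies the head that a `List⁺` demands.
encode : Subset n × Subset n → Message
encode {n} (p , q) = true ∷ encodeSet (code n) p List.++ encodeSet (code n) q

decode : Message → Subset n × Subset n
decode {n} (_ ∷ bs) = Product.map₂ (proj₁ ∘ decodeSet (code n)) (decodeSet (code n) bs)

decode-encode : (pq : Subset n × Subset n) → decode (encode pq) ≡ pq
decode-encode {n} (p , q)
  rewrite decodeSet-encodeSet (code n) (code-injective n) p (encodeSet (code n) q)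
        -- The second set ends the message; an empty rest is appended to match
        -- `decodeSet-encodeSet`.
        | cong (decodeSet (code n)) (sym (List.++-identityʳ (encodeSet (code n) q)))
        | decodeSet-encodeSet (code n) (code-injective n) q []
  = refl

-- The 3 counts the two end markers and one more codeword that pays for the leading bit.
length-encode : (p q : Subset n) →
                List⁺.length (encode (p , q)) ≤ width n * (3 + (∣ p ∣ + ∣ q ∣))
length-encode {n} p q = begin
  suc (List.length (encodeSet (code n) p List.++ encodeSet (code n) q))
    ≡⟨ cong suc (trans (List.length-++ (encodeSet (code n) p))
        (cong₂ _+_ (length-encodeSet (code n) p) (length-encodeSet (code n) q))) ⟩
  1 + ((1 + ∣ p ∣) * width n + (1 + ∣ q ∣) * width n)
    ≤⟨ +-monoˡ-≤ _ (s≤s (z≤n {⌊log₂ n ⌋})) ⟩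
  width n + ((1 + ∣ p ∣) * width n + (1 + ∣ q ∣) * width n)
    ≡⟨ collect (width n) ∣ p ∣ ∣ q ∣ ⟩
  width n * (3 + (∣ p ∣ + ∣ q ∣))  ∎
  where
  open ≤-Reasoning
  collect : ∀ w a b → w + ((1 + a) * w + (1 + b) * w) ≡ w * (3 + (a + b))
  collect = solve-∀

-- Query programs

neighbour? : (G : Graph n) (F W : Subset n) →
             Decidable (λ w → w ∈ W × ∃ λ u → u ∈ F × Edge G w u)
neighbour? G F W w = w ∈? W ×-dec Fin.any? (λ u → u ∈? F ×-dec T? (Graph.adj G w u))

neighbours : Graph n → (F W : Subset n) → Subset n
neighbours G F W = comprehension (neighbour? G F W)

module _ (G : Graph n) {F W : Subset n} where

  ∈-neighbours⁺ : ∀ {w u} → w ∈ W → u ∈ F → Edge G w u → w ∈ neighbours G F W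
  ∈-neighbours⁺ w∈W u∈F e = ∈-comprehension⁺ (neighbour? G F W) (w∈W , _ , u∈F , e)

  ∈-neighbours⁻ : ∀ {w} → w ∈ neighbours G F W → w ∈ W × ∃ λ u → u ∈ F × Edge G w u
  ∈-neighbours⁻ = ∈-comprehension⁻ (neighbour? G F W)

-- A site that knows the program knows how to continue from the answers alone.
data Program (n : ℕ) (A : Set) : Set where
  done : A → Program n A
  ask  : (F W : Subset n) → (Subset n → Program n A) → Program n A

module _ {A : Set} where

  answer : Program n A → Subset n → Program n A
  answer (done a)    S = done a
  answer (ask _ _ κ) S = κ S

  eval : Graph n → Program n A → A
  eval G (done a)    = a
  eval G (ask F W κ) = eval G (κ (neighbours G F W))

  -- The 1 per query stands for the fixed overhead of a message, which is three codewords by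
  -- `length-encode`.
  cost : Graph n → Program n A → ℕ
  cost G (done _)    = 0
  cost G (ask F W κ) = 1 + ∣ neighbours G F W ∣ + cost G (κ (neighbours G F W))

module _ {A B : Set} where

  infixl 1 _>>=_

  _>>=_ : Program n A → (A → Program n B) → Program n B
  done a    >>= f = f a
  ask F W κ >>= f = ask F W (λ S → κ S >>= f)

  eval->>= : (G : Graph n) (p : Program n A) (f : A → Program n B) →
             eval G (p >>= f) ≡ eval G (f (eval G p))
  eval->>= G (done a)    f = refl
  eval->>= G (ask F W κ) f = eval->>= G (κ _) f

  cost->>= : (G : Graph n) (p : Program n A) (f : A → Program n B) →
             cost G (p >>= f) ≡ cost G p + cost G (f (eval G p))
  cost->>= G (done a)    f = refl
  cost->>= G (ask F W κ) f =
    trans (cong (1 + ∣ neighbours G F W ∣ +_) (cost->>= G (κ _) f))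
          (sym (+-assoc (1 + ∣ neighbours G F W ∣) (cost G (κ (neighbours G F W))) _))

module _ (G : Graph n) (Gs : Vector (Graph n) k) (union : G IsUnionOf Gs) {F W : Subset n} where

  -- With `neighbours-cover` this says that the answers of the parts add up to the answer of `G`, so
  -- a query can be answered by collecting along the ring.
  neighbours-part : ∀ i → neighbours (Gs i) F W ⊆ neighbours G F W
  neighbours-part i w∈ with w∈W , u , u∈F , e ← ∈-neighbours⁻ (Gs i) w∈ =
    ∈-neighbours⁺ G w∈W u∈F (Equivalence.from (union _ _) (i , e))

  neighbours-cover : ∀ {S} → (∀ i → neighbours (Gs i) F W ⊆ S) → neighbours G F W ⊆ S
  neighbours-cover parts w∈ with w∈W , u , u∈F , e ← ∈-neighbours⁻ G w∈ =
    let i , eᵢ = Equivalence.to (union _ _) e in parts i (∈-neighbours⁺ (Gs i) w∈W u∈F eᵢ)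

-- Serves the case of one site. No ring exists there, as a site cannot send to itself, but the site
-- already holds all of `G`.
eval-single : {A : Set} (G : Graph n) (Gs : Vector (Graph n) 1) → G IsUnionOf Gs →
              (p : Program n A) → eval G p ≡ eval (Gs zero) p
eval-single G Gs union (done a) = refl
eval-single G Gs union (ask F W κ) = trans (eval-single G Gs union (κ (neighbours G F W)))
  (cong (λ S → eval (Gs zero) (κ S)) (⊆-antisym
    (neighbours-cover G Gs union (λ { zero → id }))
    (neighbours-part G Gs union zero)))

-- Running a program on a ring of sites

-- A round of the ring protocol performs one query: a message (S , A) travels
-- from the last site down to site zero, where S is the answer to the previous
-- query and A the union of the parts of the current answer collected so far.
module Ring {n m : ℕ} {Out : Set} (p₀ : Program n Out) where

  Site : Set
  Site = Fin (suc (suc m))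

  previous : Site → Site
  previous zero    = fromℕ (suc m)
  previous (suc i) = inject₁ i

  previous-≢ : ∀ i → previous i ≢ i
  previous-≢ (suc i) eq = <⇒≢ ≤-refl (trans (sym (Fin.toℕ-inject₁ i)) (cong toℕ eq))

  record State : Set where
    constructor state
    field
      program         : Program n Out
      answered parts  : Subset n

  open State

  -- On each receipt a follower advances by the previous answer. The first message has no previous
  -- answer to announce; the dummy query absorbs its `S` and leads to `p₀`.
  initial : Site → State
  initial zero    = state p₀ ⊥ ⊥
  initial (suc _) = state (ask ⊥ ⊥ λ _ → p₀) ⊥ ⊥

  -- At site zero the message has come full circle, so `A` is the complete answer. Elsewhere `A` is
  -- still partial, and the site catches up by `S`.
  receive : Site → Subset n × Subset n → State → State
  receive zero    (S , A) s = state (answer (program s) A) A ⊥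
  receive (suc _) (S , A) s = state (answer (program s) S) S A

  stateAfter : Site → History (suc (suc m)) → State
  stateAfter i []                 = initial i
  stateAfter i (sent _ _ ∷ h)     = stateAfter i h
  stateAfter i (received _ M ∷ h) = receive i (decode M) (stateAfter i h)

  act : (i : Site) → Graph n → State → Action i Out
  act i G (state (done o)    S A) = output o
  act i G (state (ask F W κ) S A) =
    send (previous i) (previous-≢ i) (encode (S , A ∪ neighbours G F W))

  protocol : Protocol (suc (suc m)) (Graph n) Out
  protocol = record
    { coins    = 0
    ; start    = zero
    ; strategy = λ i G _ h → act i G (stateAfter i h)
    }

  module _ (G : Graph n) (Gs : Vector (Graph n) (suc (suc m))) (union : G IsUnionOf Gs)
           (ω : Protocol.Randomness protocol) where

    Histories : Set
    Histories = Vector (History (suc (suc m))) (suc (suc m))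

    Reaches : Site → Histories → Out → ℕ → Set
    Reaches i h o c = ∃ λ b → Run protocol Gs ω i h b o × b ≤ c

    at : Histories → Site → State
    at h i = stateAfter i (h i)

    at-sent : ∀ (h : Histories) i {j M} j′ → at (updateAt h i (sent j M ∷_)) j′ ≡ at h j′
    at-sent h i j′ with j′ Fin.≟ i
    ... | yes refl = cong (stateAfter i) (updateAt-updates i h)
    ... | no j′≢i  = cong (stateAfter j′) (updateAt-minimal j′ i h j′≢i)

    at-received : ∀ (h : Histories) i {j} SA →
                  at (updateAt h i (received j (encode SA) ∷_)) i ≡ receive i SA (at h i)
    at-received h i SA = trans (cong (stateAfter i) (updateAt-updates i h))
      (cong (λ SA′ → receive i SA′ (at h i)) (decode-encode SA))

    at-others : ∀ (h : Histories) i {f} j → j ≢ i → at (updateAt h i f) j ≡ at h j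
    at-others h i j j≢i = cong (stateAfter j) (updateAt-minimal j i h j≢i)

    relax : ∀ {i} {h : Histories} {o c c′} → c ≤ c′ → Reaches i h o c → Reaches i h o c′
    relax c≤c′ (b , run , b≤c) = b , run , ≤-trans b≤c c≤c′

    -- The invariant between rounds: the followers lag one answer behind until the next message
    -- announces `S`.
    record Ready (q : Program n Out) (S : Subset n) (h : Histories) : Set where
      field
        leader    : at h zero ≡ state q S ⊥
        followers : ∀ j → j ≢ zero → answer (program (at h j)) S ≡ q

    module _ (F W : Subset n) (κ : Subset n → Program n Out) (S : Subset n) where

      R : Subset n
      R = neighbours G F W

      round-cost : ℕ
      round-cost = width n * (3 + (∣ S ∣ + ∣ R ∣))

      -- The message (S , A) is about to be received by site i.
      record InTransit (i : Site) (A : Subset n) (h : Histories) : Set where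
        field
          waiting : ∀ j → j ≢ zero → j Fin.≤ i → answer (program (at h j)) S ≡ ask F W κ
          passed  : ∀ j → j ≡ zero ⊎ i Fin.< j →
                    program (at h j) ≡ ask F W κ × neighbours (Gs j) F W ⊆ A
          partial : A ⊆ R

      -- Partial answers stay within `R`, which bounds the length of every message of the round.
      send-parts : ∀ i (h : Histories) A {o c} → at h i ≡ state (ask F W κ) S A → A ⊆ R →
        let A′ = A ∪ neighbours (Gs i) F W in
        Reaches (previous i) (deliver protocol Gs ω i (previous i) (encode (S , A′)) h) o c →
        Reaches i h o (round-cost + c)
      send-parts i h A at-i A⊆R (b , run , b≤c) =
        _ , sends (cong (act i (Gs i)) at-i) run , +-mono-≤ short b≤c
        where
        A′⊆R : A ∪ neighbours (Gs i) F W ⊆ R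
        A′⊆R = Sum.[ A⊆R , neighbours-part G Gs union i ]′ ∘ x∈p∪q⁻ A (neighbours (Gs i) F W)
        short : List⁺.length (encode (S , A ∪ neighbours (Gs i) F W)) ≤ round-cost
        short = ≤-trans (length-encode S (A ∪ neighbours (Gs i) F W))
          (*-monoʳ-≤ (width n) (+-monoʳ-≤ 3 (+-monoʳ-≤ ∣ S ∣ (p⊆q⇒∣p∣≤∣q∣ A′⊆R))))

      -- In continuation form, because a `Run` is built from its end: what follows the round enters
      -- as a hypothesis. From site `i` there are `toℕ i` messages left until site zero is reached.
      Relay : Site → Set
      Relay i = ∀ {j o c} (h : Histories) A → InTransit i A h →
        (∀ h′ → Ready (κ R) R h′ → Reaches zero h′ o c) →
        Reaches i (updateAt h i (received j (encode (S , A)) ∷_)) o (toℕ i * round-cost + c)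

      relay : ∀ i → Relay i
      relay = Fin.<-weakInduction Relay relay-zero relay-suc
        where
        relay-zero : Relay zero
        relay-zero {j} h A transit finish = finish _ record
          { leader    = trans (at-received h zero {j} (S , A)) (cong₂ (λ q X → state q X ⊥) κA A≡R)
          ; followers = λ j j≢0 → trans
              (cong (λ s → answer (program s) R) (at-others h zero j j≢0))
              (cong (λ q → answer q R) (proj₁ (passed j (everyone j))))
          }
          where
          open InTransit transit
          everyone : ∀ j → j ≡ zero ⊎ zero {suc m} Fin.< j
          everyone zero    = inj₁ refl
          everyone (suc j) = inj₂ (s≤s z≤n)
          -- `A` never leaves `R`, and now that all sites have contributed it also covers `R`.
          A≡R : A ≡ R
          A≡R = ⊆-antisym partial (neighbours-cover G Gs union (λ j → proj₂ (passed j (everyone j))))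
          κA : answer (program (at h zero)) A ≡ κ R
          κA = trans (cong (λ q → answer q A) (proj₁ (passed zero (inj₁ refl)))) (cong κ A≡R)

        relay-suc : ∀ i → Relay (inject₁ i) → Relay (suc i)
        relay-suc i rec {j} {c = c} h A transit finish =
          relax (≤-reflexive budget)
            (send-parts (suc i) h′ A at-i partial
              (rec (updateAt h′ (suc i) (sent (inject₁ i) (encode (S , A′)) ∷_)) A′ transit′ finish))
          where
          open InTransit transit
          A′ = A ∪ neighbours (Gs (suc i)) F W
          budget : round-cost + (toℕ (inject₁ i) * round-cost + c) ≡ suc (toℕ i) * round-cost + c
          budget = trans (sym (+-assoc round-cost (toℕ (inject₁ i) * round-cost) c))
            (cong (λ t → suc t * round-cost + c) (Fin.toℕ-inject₁ i))
          h′ = updateAt h (suc i) (received j (encode (S , A)) ∷_)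
          at-i : at h′ (suc i) ≡ state (ask F W κ) S A
          at-i = trans (at-received h (suc i) (S , A))
            (cong (λ q → state q S A) (waiting (suc i) (λ ()) ≤-refl))
          at-j : ∀ {M} j → j ≢ suc i → at (updateAt h′ (suc i) (sent (inject₁ i) M ∷_)) j ≡ at h j
          at-j j j≢i = trans (at-sent h′ (suc i) j) (at-others h (suc i) j j≢i)
          transit′ : InTransit (inject₁ i) A′ (updateAt h′ (suc i) (sent (inject₁ i) (encode (S , A′)) ∷_))
          transit′ = record
            { waiting = λ j j≢0 j≤i →
                let j<si = s≤s (subst (toℕ j ≤_) (Fin.toℕ-inject₁ i) j≤i) in
                trans (cong (λ s → answer (program s) S) (at-j j (<⇒≢ j<si ∘ cong toℕ)))
                  (waiting j j≢0 (<⇒≤ j<si))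
            ; passed  = λ j → Sum.[ (λ { refl → earlier zero (λ ()) (inj₁ refl) }) , at-or-after j ]′
            ; partial = Sum.[ partial , neighbours-part G Gs union (suc i) ]′ ∘ x∈p∪q⁻ A (neighbours (Gs (suc i)) F W)
            }
            where
            earlier : ∀ j → j ≢ suc i → j ≡ zero ⊎ suc i Fin.< j →
              program (at (updateAt h′ (suc i) (sent (inject₁ i) (encode (S , A′)) ∷_)) j) ≡ ask F W κ ×
              neighbours (Gs j) F W ⊆ A′
            earlier j j≢i j-passed =
              trans (cong program (at-j j j≢i)) (proj₁ (passed j j-passed)) ,
              (λ w∈ → x∈p∪q⁺ (inj₁ (proj₂ (passed j j-passed) w∈)))
            -- The only site newly passed is `suc i`, whose part has just been added to `A′`.
            at-or-after : ∀ j → inject₁ i Fin.< j →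
              program (at (updateAt h′ (suc i) (sent (inject₁ i) (encode (S , A′)) ∷_)) j) ≡ ask F W κ ×
              neighbours (Gs j) F W ⊆ A′
            at-or-after j i<j with j Fin.≟ suc i
            ... | yes refl = trans (cong program (at-sent h′ (suc i) (suc i))) (cong program at-i) ,
                             (λ w∈ → x∈p∪q⁺ (inj₂ w∈))
            ... | no j≢i   = earlier j j≢i (inj₂ (≤∧≢⇒<
                  (subst (_< toℕ j) (Fin.toℕ-inject₁ i) i<j) (j≢i ∘ sym ∘ Fin.toℕ-injective)))

      -- Each site sends one message: site zero opens the round, and `relay` accounts for the other
      -- `suc m`.
      round : ∀ {o c} (h : Histories) → Ready (ask F W κ) S h →
        (∀ h′ → Ready (κ R) R h′ → Reaches zero h′ o c) →
        Reaches zero h o (suc (suc m) * round-cost + c)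
      round {c = c} h ready finish =
        relax (≤-reflexive budget)
          (send-parts zero h ⊥ leader (⊥-elim ∘ ∉⊥)
            (relay last (updateAt h zero (sent last (encode (S , A)) ∷_)) A transit finish))
        where
        A = ⊥ ∪ neighbours (Gs zero) F W
        last = fromℕ (suc m)
        budget : round-cost + (toℕ last * round-cost + c) ≡ suc (suc m) * round-cost + c
        budget = trans (sym (+-assoc round-cost (toℕ last * round-cost) c))
          (cong (λ t → suc t * round-cost + c) (Fin.toℕ-fromℕ (suc m)))
        open Ready ready
        transit : InTransit last A (updateAt h zero (sent last (encode (S , A)) ∷_))
        transit = record
          { waiting = λ j j≢0 _ → trans
              (cong (λ s → answer (program s) S) (at-sent h zero j)) (followers j j≢0)
          ; passed  = λ where
              j (inj₁ refl) → trans (cong program (at-sent h zero {last} {encode (S , A)} zero)) (cong program leader) ,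
                              (λ w∈ → x∈p∪q⁺ (inj₂ w∈))
              j (inj₂ last<j) → contradiction last<j (≤⇒≯ (Fin.≤fromℕ j))
          ; partial = Sum.[ ⊥-elim ∘ ∉⊥ , neighbours-part G Gs union zero ]′ ∘ x∈p∪q⁻ ⊥ (neighbours (Gs zero) F W)
          }

    -- The size of S enters because S is only announced in the following round.
    execute : ∀ q S h → Ready q S h →
      Reaches zero h (eval G q) (suc (suc m) * (width n * (∣ S ∣ + 3 * cost G q)))
    execute (done o) S h ready = 0 , halts (cong (act zero (Gs zero)) (Ready.leader ready)) , z≤n
    execute (ask F W κ) S h ready = Product.map₂ (Product.map₂ (λ b≤ → ≤-trans b≤ (≤-trans (m≤m+n _ _)
        (≤-reflexive (regroup (suc (suc m)) (width n) ∣ S ∣ ∣ r ∣ (cost G (κ r)))))))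
      (round F W κ S h ready (execute (κ r) r))
      where
      r = neighbours G F W
      -- The third summand is slack: `r` is paid for twice, when collected and when announced, and
      -- is rounded up to three times to share the factor 3 with the overhead.
      regroup : ∀ k w s r c → k * (w * (3 + (s + r))) + k * (w * (r + 3 * c)) + k * (w * r)
                ≡ k * (w * (s + 3 * (1 + r + c)))
      regroup = solve-∀

    executes : Reaches zero (λ _ → []) (eval G p₀) (suc (suc m) * (width n * (3 * cost G p₀)))
    executes = subst (λ s → Reaches zero (λ _ → []) (eval G p₀) (suc (suc m) * (width n * (s + 3 * cost G p₀))))
      (∣⊥∣≡0 n) (execute p₀ ⊥ (λ _ → []) record
        { leader = refl ; followers = λ { zero 0≢0 → contradiction refl 0≢0 ; (suc j) _ → refl } })

compile : {A : Set} (k n : ℕ) .{{_ : NonZero k}} (p : Program n A) →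
  Σ[ P ∈ Protocol k (Graph n) A ] ∀ G Gs → G IsUnionOf Gs → ∀ ω →
    ∃ λ b → Executes P Gs ω b (eval G p) × b ≤ k * (width n * (3 * cost G p))
compile 1 n p = record { coins = 0 ; start = zero ; strategy = λ _ G _ _ → output (eval G p) } ,
  λ G Gs union ω → 0 , halts (cong output (sym (eval-single G Gs union p))) , z≤n
compile (suc (suc m)) n p = Ring.protocol p , λ G Gs union ω → Ring.executes p G Gs union ω

-- Walks and distances

module _ {G : Graph n} where

  edge-sym : ∀ {u v} → Edge G u v → Edge G v u
  edge-sym {u} {v} = subst T (Graph.sym G u v)

  infixr 5 _++ʷ_

  _++ʷ_ : ∀ {a b u v w} → Walk G a u v → Walk G b v w → Walk G (a + b) u w
  nil      ++ʷ q = q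
  cons e p ++ʷ q = cons e (p ++ʷ q)

  reverse : ∀ {a u v} → Walk G a u v → Walk G a v u
  reverse nil                = nil
  reverse {u = u} {v} (cons {ℓ = a} e p) =
    subst (λ b → Walk G b v u) (+-comm a 1) (reverse p ++ʷ cons (edge-sym e) nil)

  distance-≤-walk : ∀ {a u v} d → IsDistance G u v d → Walk G a u v → d ≤∞ [ a ]
  distance-≤-walk [ d ] (_ , least) p = [ least _ p ]
  distance-≤-walk ⊤⁺    no-walk     p = contradiction p (no-walk _)

map-walk : {G H : Graph n} → (∀ {u v} → Edge G u v → Edge H u v) →
           ∀ {a u v} → Walk G a u v → Walk H a u v
map-walk f nil        = nil
map-walk f (cons e p) = cons (f e) (map-walk f p)

-- Breadth-first search

label : ℕ → Subset n → (Fin n → ℕ∞) → Fin n → ℕ∞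
label d F distance w = if does (w ∈? F) then [ d ] else distance w

-- `t` is fuel, `F` the frontier at distance `d`, and `W` the set of vertices not yet reached;
-- whatever is left when the fuel ends counts as unreachable.
search : (t d : ℕ) (F W : Subset n) → Program n (Fin n → ℕ∞)
search zero    d F W = done (λ _ → ⊤⁺)
search (suc t) d F W = ask F W λ S → search t (suc d) S (W ∩ ∁ S) >>= (done ∘ label d F)

distancesTo : Fin n → Program n (Fin n → ℕ∞)
distancesTo {n} c = search (suc n) 0 ⁅ c ⁆ (∁ ⁅ c ⁆)

module _ (G : Graph n) where

  neighbours⊆ : ∀ F W → neighbours G F W ⊆ W
  neighbours⊆ F W = proj₁ ∘ ∈-neighbours⁻ G

  -- Answers are removed from `W`, so each vertex is reported at most once; the queries themselves
  -- contribute `t`.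
  cost-search : ∀ t d F W → cost G (search t d F W) ≤ t + ∣ W ∣
  cost-search zero    d F W = z≤n
  cost-search (suc t) d F W = begin
    1 + ∣ S ∣ + cost G (search t (suc d) S W′ >>= _)
      ≡⟨ cong (1 + ∣ S ∣ +_) (trans (cost->>= G (search t (suc d) S W′) _) (+-identityʳ _)) ⟩
    1 + ∣ S ∣ + cost G (search t (suc d) S W′)
      ≤⟨ +-monoʳ-≤ (1 + ∣ S ∣) (cost-search t (suc d) S W′) ⟩
    1 + ∣ S ∣ + (t + ∣ W′ ∣)
      ≡⟨ regroup (∣ S ∣) t (∣ W′ ∣) ⟩
    suc t + (∣ W′ ∣ + ∣ S ∣)
      ≡⟨ cong (suc t +_) (∣p∩∁q∣+∣q∣≡∣p∣ W S (neighbours⊆ F W)) ⟩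
    suc t + ∣ W ∣  ∎
    where
    open ≤-Reasoning
    S = neighbours G F W
    W′ = W ∩ ∁ S
    regroup : ∀ s t w → 1 + s + (t + w) ≡ suc t + (w + s)
    regroup = solve-∀

  module _ (c : Fin n) where

    -- The search invariant. By `closed`, a walk from `W` to `c` must enter `F` before any earlier
    -- level, so those levels can be forgotten.
    record Level (d : ℕ) (F W : Subset n) : Set where
      field
        frontier : ∀ {w} → w ∈ F → IsDistance G w c [ d ]
        beyond   : ∀ {w a} → w ∈ W → Walk G a w c → d < a
        closed   : ∀ {w u} → w ∈ W → Edge G w u → u ∈ F ⊎ u ∈ W

    next-level : ∀ {d F W} → Level d F W →
                 let S = neighbours G F W in Level (suc d) S (W ∩ ∁ S)
    next-level {d} {F} {W} level = record
      { frontier = λ w∈S → let w∈W , u , u∈F , e = ∈-neighbours⁻ G w∈S in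
          -- `d < a` unfolds to `suc d ≤ a`, so `beyond` is already the minimality required.
          cons e (proj₁ (frontier u∈F)) , λ a p → beyond w∈W p
      ; beyond   = beyond′
      ; closed   = closed′
      }
      where
      open Level level
      S = neighbours G F W
      closed′ : ∀ {w u} → w ∈ W ∩ ∁ S → Edge G w u → u ∈ S ⊎ u ∈ W ∩ ∁ S
      closed′ {w} {u} w∈W′ e with w∈W , w∈∁S ← x∈p∩q⁻ W (∁ S) w∈W′ | u ∈? S
      ... | yes u∈S = inj₁ u∈S
      ... | no  u∉S with closed w∈W e
      ...   | inj₁ u∈F = contradiction (∈-neighbours⁺ G w∈W u∈F e) (x∈∁p⇒x∉p w∈∁S)
      ...   | inj₂ u∈W = inj₂ (x∈p∩q⁺ (u∈W , x∉p⇒x∈∁p u∉S))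
      beyond′ : ∀ {w a} → w ∈ W ∩ ∁ S → Walk G a w c → suc d < a
      -- The bound `d < a` is matched along with the walk to exclude the empty walk.
      beyond′ w∈W′ p with w∈W , w∈∁S ← x∈p∩q⁻ W (∁ S) w∈W′ | p | beyond w∈W p
      ... | cons e q | _ with closed w∈W e
      ...   | inj₁ u∈F = contradiction (∈-neighbours⁺ G w∈W u∈F e) (x∈∁p⇒x∉p w∈∁S)
      ...   | inj₂ u∈W = s≤s (beyond u∈W q)

    -- A nonempty answer shrinks `W`, so the fuel condition persists. Without fuel it forces an
    -- empty frontier, and then no walk leads from `W` to `c`.
    search-correct : ∀ t d F W → Level d F W → Empty F ⊎ ∣ W ∣ < t →
                     ∀ {w} → w ∈ F ⊎ w ∈ W → IsDistance G w c (eval G (search t d F W) w)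
    search-correct zero d F W level (inj₁ empty) (inj₁ w∈F) = contradiction (_ , w∈F) empty
    search-correct zero d F W level (inj₁ empty) (inj₂ w∈W) = λ _ → trapped w∈W
      where
      open Level level
      trapped : ∀ {w a} → w ∈ W → ¬ Walk G a w c
      trapped w∈W nil with () ← beyond w∈W nil
      trapped w∈W (cons e p) with closed w∈W e
      ... | inj₁ u∈F = empty (_ , u∈F)
      ... | inj₂ u∈W = trapped u∈W p
    search-correct (suc t) d F W level fuel {w} w∈F⊎W =
      subst (IsDistance G w c) (cong-app (sym (eval->>= G rest (done ∘ label d F))) w) labelled
      where
      S = neighbours G F W
      rest = search t (suc d) S (W ∩ ∁ S)
      S-or-beyond : w ∈ W → w ∈ S ⊎ w ∈ W ∩ ∁ S
      S-or-beyond w∈W with w ∈? S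
      ... | yes w∈S = inj₁ w∈S
      ... | no  w∉S = inj₂ (x∈p∩q⁺ (w∈W , x∉p⇒x∈∁p w∉S))
      less-fuel : Empty F ⊎ ∣ W ∣ < suc t → Empty S ⊎ ∣ W ∩ ∁ S ∣ < t
      less-fuel F-fuel with nonempty? S | F-fuel
      ... | no empty | _ = inj₁ empty
      ... | yes (v , v∈S) | inj₁ F-empty =
        let _ , u , u∈F , _ = ∈-neighbours⁻ G v∈S in contradiction (u , u∈F) F-empty
      ... | yes (v , v∈S) | inj₂ (s≤s ∣W∣≤t) = inj₂ (<-≤-trans
        (p⊂q⇒∣p∣<∣q∣ (p∩q⊆p W (∁ S) , v , neighbours⊆ F W v∈S ,
          λ v∈W′ → x∈∁p⇒x∉p (proj₂ (x∈p∩q⁻ W (∁ S) v∈W′)) v∈S))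
        ∣W∣≤t)
      labelled : IsDistance G w c (label d F (eval G rest) w)
      labelled with w ∈? F
      ... | yes w∈F = Level.frontier level w∈F
      ... | no  w∉F = search-correct t (suc d) S (W ∩ ∁ S) (next-level level) (less-fuel fuel)
        (Sum.[ (λ w∈F → contradiction w∈F w∉F) , S-or-beyond ]′ w∈F⊎W)

    distancesTo-correct : ∀ w → IsDistance G w c (eval G (distancesTo c) w)
    distancesTo-correct w = search-correct (suc n) 0 ⁅ c ⁆ (∁ ⁅ c ⁆)
      record { frontier = frontier ; beyond = beyond ; closed = λ {_} {u} _ _ → split u }
      (inj₂ (s≤s (∣p∣≤n (∁ ⁅ c ⁆)))) (split w)
      where
      split : ∀ w → w ∈ ⁅ c ⁆ ⊎ w ∈ ∁ ⁅ c ⁆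
      split w with w ∈? ⁅ c ⁆
      ... | yes w∈ = inj₁ w∈
      ... | no  w∉ = inj₂ (x∉p⇒x∈∁p w∉)
      frontier : ∀ {w} → w ∈ ⁅ c ⁆ → IsDistance G w c [ 0 ]
      frontier w∈ with refl ← x∈⁅y⁆⇒x≡y c w∈ = nil , λ _ _ → z≤n
      beyond : ∀ {w a} → w ∈ ∁ ⁅ c ⁆ → Walk G a w c → 0 < a
      beyond c∈ nil        = contradiction (x∈⁅x⁆ c) (x∈∁p⇒x∉p c∈)
      beyond _  (cons _ _) = s≤s z≤n

    cost-distancesTo : cost G (distancesTo c) ≤ suc n + n
    cost-distancesTo = ≤-trans (cost-search (suc n) 0 ⁅ c ⁆ (∁ ⁅ c ⁆))
      (+-monoʳ-≤ (suc n) (∣p∣≤n (∁ ⁅ c ⁆)))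

distancesToAll : List (Fin n) → Program n (List (Fin n → ℕ∞))
distancesToAll []       = done []
distancesToAll (c ∷ cs) = distancesTo c >>= λ d → distancesToAll cs >>= λ ds → done (d ∷ ds)

eval-distancesToAll : (G : Graph n) (cs : List (Fin n)) →
  eval G (distancesToAll cs) ≡ List.map (λ c → eval G (distancesTo c)) cs
eval-distancesToAll G []       = refl
eval-distancesToAll G (c ∷ cs) = trans (eval->>= G (distancesTo c) _)
  (trans (eval->>= G (distancesToAll cs) _) (cong (_ ∷_) (eval-distancesToAll G cs)))

cost-distancesToAll : (G : Graph n) (cs : List (Fin n)) →
  cost G (distancesToAll cs) ≤ List.length cs * (suc n + n)
cost-distancesToAll G []       = z≤n
cost-distancesToAll {n} G (c ∷ cs) = begin
  cost G (distancesTo c >>= _)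
    ≡⟨ cost->>= G (distancesTo c) _ ⟩
  cost G (distancesTo c) + cost G (distancesToAll cs >>= _)
    ≡⟨ cong (cost G (distancesTo c) +_) (trans (cost->>= G (distancesToAll cs) _) (+-identityʳ _)) ⟩
  cost G (distancesTo c) + cost G (distancesToAll cs)
    ≤⟨ +-mono-≤ (cost-distancesTo G c) (cost-distancesToAll G cs) ⟩
  suc n + n + List.length cs * (suc n + n)  ∎
  where open ≤-Reasoning

-- Clustering around vertices of high degree

record Clustering (n : ℕ) : Set where
  constructor clustering
  field
    centres     : List (Fin n)
    unclustered : Subset n
    known       : Fin n → Subset n

open Clustering

addCentre : Fin n → Clustering n → Clustering n
addCentre v r = record r { centres = v ∷ centres r }

addKnown : Fin n → Subset n → Clustering n → Clustering n
addKnown v S r = record r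
  { known = λ u → if does (u Fin.≟ v) then S ∪ known r u else known r u }

mutual
  cluster : (s : ℕ) → List (Fin n) → Subset n → Program n (Clustering n)
  cluster s []       U = done (clustering [] U (λ _ → ⊥))
  cluster s (v ∷ vs) U = ask ⁅ v ⁆ U λ S → clusterAfter s v vs U S (does (s ≤? ∣ S ∣))

  -- The outcome of the size test is an argument, so that proofs can split on the decision itself.
  clusterAfter : (s : ℕ) → Fin n → List (Fin n) → (U S : Subset n) → Bool → Program n (Clustering n)
  clusterAfter s v vs U S true  = cluster s vs (U ∩ ∁ S) >>= (done ∘ addCentre v ∘ addKnown v S)
  clusterAfter s v vs U S false = cluster s vs U >>= (done ∘ addKnown v S)

module _ (G : Graph n) (s : ℕ) where

  record Valid (vs : List (Fin n)) (U : Subset n) (r : Clustering n) : Set where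
    field
      shrinking : unclustered r ⊆ U
      sound     : ∀ {v w} → w ∈ known r v → Edge G w v
      complete  : ∀ {v w} → v ∈ˡ vs → w ∈ unclustered r → Edge G w v → w ∈ known r v
      covered   : ∀ {w} → w ∈ U → w ∉ unclustered r → ∃ λ c → c ∈ˡ centres r × Edge G w c
      few       : List.length (centres r) * s + ∣ unclustered r ∣ ≤ ∣ U ∣

  module _ (v : Fin n) (U : Subset n) where

    private
      S : Subset n
      S = neighbours G ⁅ v ⁆ U

    ∈-star⁻ : ∀ {w} → w ∈ S → Edge G w v
    ∈-star⁻ w∈S with _ , u , u∈ , e ← ∈-neighbours⁻ G w∈S with refl ← x∈⁅y⁆⇒x≡y v u∈ = e

    ∈-star⁺ : ∀ {w} → w ∈ U → Edge G w v → w ∈ S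
    ∈-star⁺ w∈U e = ∈-neighbours⁺ G w∈U (x∈⁅x⁆ v) e

    known-sound : ∀ {r} → (∀ {x w} → w ∈ known r x → Edge G w x) →
                  ∀ {x w} → w ∈ known (addKnown v S r) x → Edge G w x
    known-sound {r} sound {x} w∈ with x Fin.≟ v
    ... | yes refl = Sum.[ ∈-star⁻ , sound ]′ (x∈p∪q⁻ S (known r v) w∈)
    ... | no  _    = sound w∈

    -- A vertex unclustered at the end was unclustered when `v` was processed, so the answer `S`
    -- contained it if it was a neighbour of `v`.
    known-complete : ∀ {vs r} → unclustered r ⊆ U →
      (∀ {x w} → x ∈ˡ vs → w ∈ unclustered r → Edge G w x → w ∈ known r x) →
      ∀ {x w} → x ∈ˡ v ∷ vs → w ∈ unclustered r → Edge G w x → w ∈ known (addKnown v S r) x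
    known-complete {r = r} shrinking complete {x} x∈ w∈ e with x Fin.≟ v | x∈
    ... | yes refl | _              = x∈p∪q⁺ (inj₁ (∈-star⁺ (shrinking w∈) e))
    ... | no  x≢v  | Any.here x≡v   = contradiction x≡v x≢v
    ... | no  _    | Any.there x∈vs = complete x∈vs w∈ e

    valid-light : ∀ {vs r} → Valid vs U r → Valid (v ∷ vs) U (addKnown v S r)
    valid-light {vs} {r} valid = record
      { shrinking = shrinking
      ; sound     = known-sound {r} sound
      ; complete  = known-complete {vs} {r} shrinking complete
      ; covered   = covered
      ; few       = few
      }
      where open Valid valid

    -- The new centre removes at least `s` vertices from `U`, and these pay for its term in `few`.
    valid-heavy : ∀ {vs r} → s ≤ ∣ S ∣ → Valid vs (U ∩ ∁ S) r →
                  Valid (v ∷ vs) U (addCentre v (addKnown v S r))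
    valid-heavy {vs} {r} s≤∣S∣ valid = record
      { shrinking = p∩q⊆p U (∁ S) ∘ shrinking
      ; sound     = known-sound {r} sound
      ; complete  = known-complete {vs} {r} (p∩q⊆p U (∁ S) ∘ shrinking) complete
      ; covered   = covered′
      ; few       = few′
      }
      where
      open Valid valid
      covered′ : ∀ {w} → w ∈ U → w ∉ unclustered r → ∃ λ c → c ∈ˡ v ∷ centres r × Edge G w c
      covered′ {w} w∈U w∉ with w ∈? S
      ... | yes w∈S = v , Any.here refl , ∈-star⁻ w∈S
      ... | no  w∉S = Product.map₂ (Product.map₁ Any.there)
                        (covered (x∈p∩q⁺ (w∈U , x∉p⇒x∈∁p w∉S)) w∉)
      few′ : suc (List.length (centres r)) * s + ∣ unclustered r ∣ ≤ ∣ U ∣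
      few′ = begin
        s + List.length (centres r) * s + ∣ unclustered r ∣
          ≡⟨ +-assoc s (List.length (centres r) * s) _ ⟩
        s + (List.length (centres r) * s + ∣ unclustered r ∣)
          ≤⟨ +-mono-≤ s≤∣S∣ few ⟩
        ∣ S ∣ + ∣ U ∩ ∁ S ∣
          ≡⟨ +-comm (∣ S ∣) _ ⟩
        ∣ U ∩ ∁ S ∣ + ∣ S ∣
          ≡⟨ ∣p∩∁q∣+∣q∣≡∣p∣ U S (neighbours⊆ G ⁅ v ⁆ U) ⟩
        ∣ U ∣  ∎
        where open ≤-Reasoning

  cluster-valid : ∀ vs U → Valid vs U (eval G (cluster s vs U))
  cluster-valid [] U = record
    { shrinking = id
    ; sound     = ⊥-elim ∘ ∉⊥
    ; complete  = λ ()
    ; covered   = λ w∈U w∉U → contradiction w∈U w∉U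
    ; few       = ≤-refl
    }
  cluster-valid (v ∷ vs) U = by-size (s ≤? ∣ S ∣)
    where
    S = neighbours G ⁅ v ⁆ U
    by-size : (heavy? : Dec (s ≤ ∣ S ∣)) → Valid (v ∷ vs) U 
      (eval G (clusterAfter s v vs U S (does heavy?)))
    by-size (yes heavy) = subst (Valid (v ∷ vs) U)
      (sym (eval->>= G (cluster s vs (U ∩ ∁ S)) _))
      (valid-heavy v U heavy (cluster-valid vs (U ∩ ∁ S)))
    by-size (no light)  = subst (Valid (v ∷ vs) U)
      (sym (eval->>= G (cluster s vs U) _))
      (valid-light v U (cluster-valid vs U))

  -- Answers of size at least s are paid for by the vertices they cluster.
  cost-cluster : ∀ vs U → cost G (cluster s vs U) ≤ List.length vs * (1 + s) + ∣ U ∣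
  cost-cluster []       U = z≤n
  cost-cluster (v ∷ vs) U = by-size (s ≤? ∣ S ∣)
    where
    open ≤-Reasoning
    S = neighbours G ⁅ v ⁆ U
    l = List.length vs * (1 + s)
    regroup : ∀ s l u → 1 + s + (l + u) ≡ 1 + l + (u + s)
    regroup = solve-∀
    by-size : (heavy? : Dec (s ≤ ∣ S ∣)) → 
      1 + ∣ S ∣ + cost G (clusterAfter s v vs U S (does heavy?)) ≤ 1 + s + l + ∣ U ∣
    by-size (yes _) = begin
      1 + ∣ S ∣ + cost G (cluster s vs (U ∩ ∁ S) >>= _)
        ≡⟨ cong (1 + ∣ S ∣ +_) (trans (cost->>= G (cluster s vs (U ∩ ∁ S)) _) (+-identityʳ _)) ⟩
      1 + ∣ S ∣ + cost G (cluster s vs (U ∩ ∁ S))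
        ≤⟨ +-monoʳ-≤ (1 + ∣ S ∣) (cost-cluster vs (U ∩ ∁ S)) ⟩
      1 + ∣ S ∣ + (l + ∣ U ∩ ∁ S ∣)
        ≡⟨ regroup (∣ S ∣) l (∣ U ∩ ∁ S ∣) ⟩
      1 + l + (∣ U ∩ ∁ S ∣ + ∣ S ∣)
        ≡⟨ cong (1 + l +_) (∣p∩∁q∣+∣q∣≡∣p∣ U S (neighbours⊆ G ⁅ v ⁆ U)) ⟩
      1 + l + ∣ U ∣
        ≤⟨ +-monoˡ-≤ (∣ U ∣) (+-monoˡ-≤ l (m≤m+n 1 s)) ⟩
      1 + s + l + ∣ U ∣  ∎
    by-size (no light) = begin
      1 + ∣ S ∣ + cost G (cluster s vs U >>= _)
        ≡⟨ cong (1 + ∣ S ∣ +_) (trans (cost->>= G (cluster s vs U) _) (+-identityʳ _)) ⟩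
      1 + ∣ S ∣ + cost G (cluster s vs U)
        ≤⟨ +-mono-≤ (s≤s (≰⇒≥ light)) (cost-cluster vs U) ⟩
      1 + s + (l + ∣ U ∣)
        ≡⟨ +-assoc (1 + s) l _ ⟨
      1 + s + l + ∣ U ∣  ∎

-- Estimating distances

module _ (K : Fin n → Subset n) where

  -- Symmetrised and without loops, so that any `K` yields a `Graph`; a clustering may record an
  -- edge at one end only.
  known? : ∀ u v → Dec (u ≢ v × (u ∈ K v ⊎ v ∈ K u))
  known? u v = ¬? (u Fin.≟ v) ×-dec (u ∈? K v ⊎-dec v ∈? K u)

  knownGraph : Graph n
  knownGraph = record
    { adj    = λ u v → does (known? u v)
    ; sym    = λ u v → does-⇔ (mk⇔ swap-known swap-known) (known? u v) (known? v u)
    ; irrefl = λ u → dec-false (known? u u) (λ (u≢u , _) → u≢u refl)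
    }
    where
    swap-known : ∀ {u v} → u ≢ v × (u ∈ K v ⊎ v ∈ K u) → v ≢ u × (v ∈ K u ⊎ u ∈ K v)
    swap-known = Product.map (_∘ sym) Sum.swap

  known⇒edge : ∀ {u v} → u ≢ v → u ∈ K v ⊎ v ∈ K u → Edge knownGraph u v
  known⇒edge {u} {v} u≢v uv = subst T (sym (dec-true (known? u v) (u≢v , uv))) _

  edge⇒known : ∀ {u v} → Edge knownGraph u v → u ∈ K v ⊎ v ∈ K u
  edge⇒known {u} {v} e = proj₂ (toWitness {a? = known? u v} (subst T (sym (isYes≗does (known? u v))) e))

totalOrder : TotalOrder _ _ _
totalOrder = record { isTotalOrder = ≤⁺-isTotalOrder-≡ ≤-isTotalOrder }

open Data.List.Extrema totalOrder using (max; min; v≤max⁺; max≤v⁺; min≤v⁺; v≤min⁺)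

≤∞-refl : ∀ {d} → d ≤∞ d
≤∞-refl = TotalOrder.refl totalOrder

≤∞-trans : ∀ {a b c} → a ≤∞ b → b ≤∞ c → a ≤∞ c
≤∞-trans = ≤⁺-trans ≤-trans

0≤+∞ : ∀ (d : ℕ∞) {m} → [ 0 ] ≤∞ (d +∞ m)
0≤+∞ [ _ ] = [ z≤n ]
0≤+∞ ⊤⁺    = _ ≤⊤⁺

_⊕_ : ℕ∞ → ℕ∞ → ℕ∞
[ a ] ⊕ [ b ] = [ a + b ]
[ _ ] ⊕ ⊤⁺    = ⊤⁺
⊤⁺    ⊕ _     = ⊤⁺

⊕-mono : ∀ {a b a′ b′} → a ≤∞ [ a′ ] → b ≤∞ [ b′ ] → (a ⊕ b) ≤∞ [ a′ + b′ ]
⊕-mono [ p ] [ q ] = [ +-mono-≤ p q ]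

-- The search in `H` is evaluated locally, without communication.
estimate : Graph n → List (Fin n → ℕ∞) → Fin n → Fin n → ℕ∞
estimate H ds u v = min (eval H (distancesTo v) u) (List.map (λ d → d u ⊕ d v) ds)

pairs : ∀ n → List (Fin n × Fin n)
pairs n = List.cartesianProduct (List.allFin n) (List.allFin n)

largest : (Fin n → Fin n → ℕ∞) → ℕ∞
-- `[ 0 ]` is the least element of `ℕ∞`, so starting from it does not alter the maximum.
largest {n} e = max [ 0 ] (List.map (uncurry e) (pairs n))

≤-largest : (e : Fin n → Fin n → ℕ∞) → ∀ u v → e u v ≤∞ largest e
≤-largest {n} e u v = v≤max⁺ [ 0 ] (List.map (uncurry e) (pairs n)) (inj₂
  (lose (∈-map⁺ (uncurry e) (∈-cartesianProduct⁺ (∈-allFin u) (∈-allFin v))) ≤∞-refl))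

largest-≤ : (e : Fin n → Fin n → ℕ∞) → ∀ {b} → [ 0 ] ≤∞ b → (∀ u v → e u v ≤∞ b) → largest e ≤∞ b
largest-≤ {n} e 0≤b e≤b =
  max≤v⁺ {xs = List.map (uncurry e) (pairs n)} 0≤b (All.map⁺ (All.universal (uncurry e≤b) (pairs n)))

module _ (G : Graph n) (s : ℕ) {r : Clustering n} (valid : Valid G s (List.allFin n) ⊤ r) where

  open Valid valid

  private
    H : Graph n
    H = knownGraph (known r)
    distances : List (Fin n → ℕ∞)
    distances = List.map (λ c → eval G (distancesTo c)) (centres r)

  H⊆G : ∀ {u v} → Edge H u v → Edge G u v
  H⊆G e = Sum.[ sound , edge-sym {G = G} ∘ sound ]′ (edge⇒known (known r) e)

  edge-≢ : ∀ {u v} → Edge G u v → u ≢ v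
  edge-≢ {u} e refl = subst T (Graph.irrefl G u) e

  -- Every vertex has been processed, in particular `v`, whose recorded set then contains `u`.
  unclustered-edge : ∀ {u v} → u ∈ unclustered r → Edge G u v → Edge H u v
  unclustered-edge u∈ e = known⇒edge (known r) (edge-≢ e) (inj₁ (complete (∈-allFin _) u∈ e))

  record Detour (a : ℕ) (u v : Fin n) : Set where
    field
      {before after} : ℕ
      {via centre}   : Fin n
      enter          : Walk G before u via
      leave          : Walk G after via v
      length         : before + after ≡ a
      spoke          : Edge G via centre
      isCentre       : centre ∈ˡ centres r

  -- Follow the walk to the first edge that starts at a clustered vertex; all edges before it are
  -- known. The end of the walk is not tested, as the last edge is judged by its start.
  known-or-detour : ∀ {a u v} → Walk G a u v → Walk H a u v ⊎ Detour a u v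
  known-or-detour nil = inj₁ nil
  known-or-detour {u = u} (cons e p) with u ∈? unclustered r
  ... | yes u∈ = Sum.map (cons (unclustered-edge u∈ e))
                   (λ d → let open Detour d in record
                     { enter = cons e enter ; leave = leave ; length = cong suc length
                     ; spoke = spoke ; isCentre = isCentre })
                   (known-or-detour p)
  ... | no u∉ = let c , c∈ , uc = covered ∈⊤ u∉ in inj₂ record
    { enter = nil ; leave = cons e p ; length = refl ; spoke = uc ; isCentre = c∈ }

  estimate-upper : ∀ {a u v} → Walk G a u v → estimate H distances u v ≤∞ [ a + 2 ]
  estimate-upper {a} {u} {v} p = min≤v⁺ _ _ (Sum.map direct around (known-or-detour p))
    where
    direct : Walk H a u v → eval H (distancesTo v) u ≤∞ [ a + 2 ]
    direct q = ≤∞-trans (distance-≤-walk _ (distancesTo-correct H v u) q) [ m≤m+n a 2 ]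
    around : Detour a u v → Any (_≤∞ [ a + 2 ]) (List.map (λ d → d u ⊕ d v) distances)
    around detour = lose (∈-map⁺ (λ d → d u ⊕ d v) (∈-map⁺ (λ c → eval G (distancesTo c)) isCentre))
      (subst (λ b → (toCentre u ⊕ toCentre v) ≤∞ [ b ]) total
        (⊕-mono (within u (enter ++ʷ cons spoke nil)) (within v (reverse leave ++ʷ cons spoke nil))))
      where
      open Detour detour
      toCentre : Fin n → ℕ∞
      toCentre = eval G (distancesTo centre)
      within : ∀ w {b} → Walk G b w centre → toCentre w ≤∞ [ b ]
      within w = distance-≤-walk (toCentre w) (distancesTo-correct G centre w)
      regroup : ∀ b c → b + 1 + (c + 1) ≡ b + c + 2
      regroup = solve-∀
      total : before + 1 + (after + 1) ≡ a + 2
      total = trans (regroup before after) (cong (_+ 2) length)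

  -- Every finite candidate of the minimum is the length of a walk in `G`: either a walk of `H`, or
  -- two shortest walks joined at a centre.
  estimate-lower : ∀ {u v d} → IsDistance G u v d → d ≤∞ estimate H distances u v
  estimate-lower {u} {v} {d} isDistance = v≤min⁺
    (at-least _ (distancesTo-correct H v u))
    (All.map⁺ (All.map⁺ (All.universal
      (λ c → through (distancesTo-correct G c u) (distancesTo-correct G c v)) (centres r))))
    where
    at-least : ∀ h → IsDistance H u v h → d ≤∞ h
    at-least [ h ] (p , _) = distance-≤-walk d isDistance (map-walk {G = H} {H = G} H⊆G p)
    at-least ⊤⁺    _       = d ≤⊤⁺
    through : ∀ {c x y} → IsDistance G u c x → IsDistance G v c y → d ≤∞ (x ⊕ y)
    through {x = [ _ ]} {[ _ ]} (p , _) (q , _) = distance-≤-walk d isDistance (p ++ʷ reverse q)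
    through {x = [ _ ]} {⊤⁺}    _       _       = d ≤⊤⁺
    through {x = ⊤⁺}            _       _       = d ≤⊤⁺

  estimate-diameter : ∀ {D} → IsDiameter G D →
    let D̃ = largest (estimate H distances) in D ≤∞ D̃ × D̃ ≤∞ (D +∞ 2)
  estimate-diameter {D} ((u , v , attained) , bound) =
    ≤∞-trans (estimate-lower attained) (≤-largest (estimate H distances) u v) ,
    largest-≤ (estimate H distances) (0≤+∞ D) (λ u v →
      -- Evaluated on `G`, `distancesTo` merely supplies the distance of `u` and `v`, to which
      -- `bound` applies.
      upper u v (bound u v _ (distancesTo-correct G v u)) (distancesTo-correct G v u))
    where
    upper : ∀ u v {d} → d ≤∞ D → IsDistance G u v d → estimate H distances u v ≤∞ (D +∞ 2)
    upper u v (_ ≤⊤⁺) _       = _ ≤⊤⁺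
    upper u v [ d≤D ] (p , _) = ≤∞-trans (estimate-upper p) [ +-monoˡ-≤ 2 d≤D ]

-- The diameter program and its cost

diameterProgram : (s n : ℕ) → Program n ℕ∞
diameterProgram s n = cluster s (List.allFin n) ⊤ >>= λ r → distancesToAll (centres r) >>= λ ds →
  done (largest (estimate (knownGraph (known r)) ds))

module _ (G : Graph n) (s : ℕ) where

  private
    r : Clustering n
    r = eval G (cluster s (List.allFin n) ⊤)

  diameterProgram-correct : ∀ {D} → IsDiameter G D →
    D ≤∞ eval G (diameterProgram s n) × eval G (diameterProgram s n) ≤∞ (D +∞ 2)
  diameterProgram-correct {D} isDiameter =
    subst (λ D̃ → D ≤∞ D̃ × D̃ ≤∞ (D +∞ 2)) (sym evaluated)
      (estimate-diameter G s (cluster-valid G s (List.allFin n) ⊤) isDiameter)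
    where
    evaluated : eval G (diameterProgram s n) ≡
      largest (estimate (knownGraph (known r)) (List.map (λ c → eval G (distancesTo c)) (centres r)))
    evaluated = trans (eval->>= G (cluster s (List.allFin n) ⊤) _)
      (trans (eval->>= G (distancesToAll (centres r)) _)
        (cong (λ ds → largest (estimate (knownGraph (known r)) ds)) (eval-distancesToAll G (centres r))))

  -- Clustering costs about n · s, and the searches from at most s centres about 2n each. The
  -- remaining n + n + s is absorbed into three more terms n · s.
  cost-diameterProgram : .{{_ : NonZero s}} .{{_ : NonZero n}} → n ≤ s * s →
                         cost G (diameterProgram s n) ≤ 6 * (n * s)
  cost-diameterProgram n≤s² = begin
    cost G (diameterProgram s n)
      ≡⟨ cost->>= G (cluster s (List.allFin n) ⊤) _ ⟩
    cost G (cluster s (List.allFin n) ⊤) + cost G (distancesToAll (centres r) >>= _)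
      ≡⟨ cong (cost G (cluster s (List.allFin n) ⊤) +_)
           (trans (cost->>= G (distancesToAll (centres r)) _) (+-identityʳ _)) ⟩
    cost G (cluster s (List.allFin n) ⊤) + cost G (distancesToAll (centres r))
      ≤⟨ +-mono-≤ (cost-cluster G s (List.allFin n) ⊤) (cost-distancesToAll G (centres r)) ⟩
    List.length (List.allFin n) * (1 + s) + ∣ ⊤ {n} ∣ + List.length (centres r) * (suc n + n)
      ≤⟨ +-mono-≤ (≤-reflexive (cong₂ (λ a b → a * (1 + s) + b) (List.length-tabulate {n = n} id) (∣⊤∣≡n n)))
           (*-monoˡ-≤ (suc n + n) few-centres) ⟩
    n * (1 + s) + n + s * (suc n + n)
      ≡⟨ regroup n s ⟩
    n + n + s + 3 * (n * s)
      ≤⟨ +-monoˡ-≤ (3 * (n * s)) (+-mono-≤ (+-mono-≤ (m≤m*n n s) (m≤m*n n s)) (m≤n*m s n)) ⟩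
    n * s + n * s + n * s + 3 * (n * s)
      ≡⟨ collect (n * s) ⟩
    6 * (n * s)  ∎
    where
    open ≤-Reasoning
    few-centres : List.length (centres r) ≤ s
    few-centres = *-cancelʳ-≤ (List.length (centres r)) s s (begin
      List.length (centres r) * s          ≤⟨ m≤m+n _ _ ⟩
      List.length (centres r) * s + ∣ unclustered r ∣
        ≤⟨ Valid.few (cluster-valid G s (List.allFin n) ⊤) ⟩
      ∣ ⊤ {n} ∣                            ≡⟨ ∣⊤∣≡n n ⟩
      n                                    ≤⟨ n≤s² ⟩
      s * s                                ∎)
    regroup : ∀ n s → n * (1 + s) + n + s * (suc n + n) ≡ n + n + s + 3 * (n * s)
    regroup = solve-∀
    collect : ∀ x → x + x + x + 3 * x ≡ 6 * x
    collect = solve-∀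

-- Keep `s` as long as it suffices. Otherwise n = s · s, and (s + 1)² ≤ 4 (n + 1) because s ≤ s².
√-upTo : ∀ n → ∃ λ s → n ≤ s * s × s * s ≤ 4 * n
√-upTo zero = 0 , z≤n , z≤n
√-upTo (suc n) with s , n≤s² , s²≤4n ← √-upTo n | suc n ≤? s * s
... | yes n<s² = s , n<s² , ≤-trans s²≤4n (*-monoʳ-≤ 4 (n≤1+n n))
... | no  n≮s² = suc s , s≤s (≤-trans n≤s² (≤-trans (*-monoʳ-≤ s (n≤1+n s)) (m≤n+m _ s))) , (begin
  suc s * suc s                       ≡⟨ expand s ⟩
  1 + (s + s) + s * s                 ≤⟨ +-monoˡ-≤ (s * s) (s≤s (+-mono-≤ (m≤m² s) (m≤m² s))) ⟩
  1 + (s * s + s * s) + s * s         ≤⟨ m≤m+n _ (3 + s * s) ⟩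
  1 + (s * s + s * s) + s * s + (3 + s * s) ≡⟨ collect (s * s) ⟩
  4 * suc (s * s)             ≡⟨ cong (λ m → 4 * suc m) (≤-antisym (≤-pred (≰⇒> n≮s²)) n≤s²) ⟩
  4 * suc n                           ∎)
  where
  open ≤-Reasoning
  m≤m² : ∀ m → m ≤ m * m
  m≤m² zero    = z≤n
  m≤m² (suc m) = m≤m*n (suc m) (suc m)
  expand : ∀ s → suc s * suc s ≡ 1 + (s + s) + s * s
  expand = solve-∀
  collect : ∀ q → 1 + (q + q) + q + (3 + q) ≡ 4 * suc q
  collect = solve-∀

√↑ : ℕ → ℕ
√↑ n = proj₁ (√-upTo n)

√↑-nonZero : ∀ n .{{_ : NonZero n}} → NonZero (√↑ n)
√↑-nonZero (suc n) with √-upTo (suc n)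
... | suc _ , _ = _

-- The constant is 72 = 3 · 6 · 2 · 2: one 2 comes from `width n ≤ 2 * l ^ 2`, where n ≥ 2 makes the
-- logarithm positive, the other is the root of the 4 in `√-upTo`.
costBound : ∀ k n b → n ≥ 2 → b ≤ k * (width n * (3 * (6 * (n * √↑ n)))) → CostBound 72 k n b
costBound k n b n≥2 b≤ = begin
  b ^ 2
    ≤⟨ ^-monoˡ-≤ 2 (≤-trans b≤ (*-monoʳ-≤ k (*-monoˡ-≤ (3 * (6 * (n * s))) width≤2l²))) ⟩
  (k * (2 * l ^ 2 * (3 * (6 * (n * s))))) ^ 2
    ≡⟨ separate k (l ^ 2) n s ⟩
  (36 * k * l ^ 2) ^ 2 * n ^ 2 * (s * s)
    ≤⟨ *-monoʳ-≤ ((36 * k * l ^ 2) ^ 2 * n ^ 2) (proj₂ (proj₂ (√-upTo n))) ⟩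
  (36 * k * l ^ 2) ^ 2 * n ^ 2 * (4 * n)
    ≡⟨ collect k (l ^ 2) n ⟩
  (72 * k * l ^ 2) ^ 2 * n ^ 3  ∎
  where
  open ≤-Reasoning
  s = √↑ n
  l = ⌊log₂ n ⌋
  1≤l : 1 ≤ l
  1≤l = ⌊log₂⌋-mono-≤ n≥2
  width≤2l² : width n ≤ 2 * l ^ 2
  width≤2l² = begin
    1 + l      ≤⟨ +-monoˡ-≤ l 1≤l ⟩
    l + l      ≡⟨ cong (l +_) (+-identityʳ l) ⟨
    2 * l      ≤⟨ *-monoʳ-≤ 2 (m≤m*n l (l ^ 1) {{m^n≢0 l 1 {{>-nonZero 1≤l}}}}) ⟩
    2 * l ^ 2  ∎
  -- x ^ 2 is spelled x * (x * 1), to which it unfolds: the solver rejects _^_.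
  separate : ∀ k q n s → let x = k * (2 * q * (3 * (6 * (n * s)))) ; y = 36 * k * q in
             x * (x * 1) ≡ y * (y * 1) * (n * (n * 1)) * (s * s)
  separate = solve-∀
  collect : ∀ k q n → let y = 36 * k * q ; z = 72 * k * q in
            y * (y * 1) * (n * (n * 1)) * (4 * n) ≡ z * (z * 1) * (n * (n * (n * 1)))
  collect = solve-∀

record Approximates (n : ℕ) (p : Program n ℕ∞) : Set where
  field
    correct : ∀ G {D} → IsDiameter G D → D ≤∞ eval G p × eval G p ≤∞ (D +∞ 2)
    cheap   : ∀ k G b → b ≤ k * (width n * (3 * cost G p)) → CostBound 72 k n b

-- On one vertex the cost bound is zero because ⌊log₂ 1⌋ = 0, so nothing may be asked.
approximation : ∀ n .{{_ : NonZero n}} → ∃ (Approximates n)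
approximation 1 = done [ 0 ] , record
  { correct = λ { G ((zero , zero , attained) , _) → single attained }
  ; cheap   = λ k G b b≤ → subst (λ b → CostBound 72 k 1 b)
      (sym (n≤0⇒n≡0 (≤-trans b≤ (≤-reflexive (*-zeroʳ k))))) z≤n
  }
  where
  single : ∀ {G : Graph 1} {D} → IsDistance G zero zero D → D ≤∞ [ 0 ] × [ 0 ] ≤∞ (D +∞ 2)
  single {D = [ d ]} (_ , least) = [ least 0 nil ] , 0≤+∞ [ d ]
  single {D = ⊤⁺}    no-walk     = contradiction nil (no-walk 0)
approximation n@(suc (suc _)) = diameterProgram (√↑ n) n , record
  { correct = λ G → diameterProgram-correct G (√↑ n)
  ; cheap   = λ k G b b≤ → costBound k n b (s≤s (s≤s z≤n)) (≤-trans b≤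
      (*-monoʳ-≤ k (*-monoʳ-≤ (width n) (*-monoʳ-≤ 3
        (cost-diameterProgram G (√↑ n) {{√↑-nonZero n}} (proj₁ (proj₂ (√-upTo n))))))))
  }

-- The filter keeps the whole sample space, so the probability is one, above 99 / 100.
certain : ∀ {In Out} (P : Protocol k In Out) {E : Pred (Protocol.Randomness P) _} →
          (∀ ω → E ω) → ProbAtLeast P 99 100 E
certain P always = (λ ω → yes (always ω)) ,
  ≤-trans (*-monoˡ-≤ (List.length (sampleSpace P)) (n≤1+n 99))
    (*-monoʳ-≤ 100 (≤-reflexive (cong List.length
      (sym (List.filter-all (λ ω → yes (always ω)) (All.universal always (sampleSpace P)))))))

theorem6p11 : ∃[ C ] ∀ (k n : ℕ) .{{_ : NonZero k}} .{{_ : NonZero n}} →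
    Σ[ P ∈ Protocol k (Graph n) ℕ∞ ]
    ∀ (G : Graph n) (Gs : Vector (Graph n) k) → G IsUnionOf Gs →
    (∀ ω → ∃₂ λ b o → Executes P Gs ω b o × CostBound C k n b)
    × (∀ D → IsDiameter G D →
    ProbAtLeast P 99 100
    (λ ω → ∃₂ λ b D̃ → Executes P Gs ω b D̃ × D ≤∞ D̃ × D̃ ≤∞ (D +∞ 2)))
theorem6p11 = 72 , λ k n →
  let p , approximates = approximation n
      open Approximates approximates
      P , runs = compile k n p
  in P , λ G Gs union →
    (λ ω → let b , run , b≤ = runs G Gs union ω in b , eval G p , run , cheap k G b b≤) ,
    (λ D isDiameter → certain P λ ω →
      let b , run , _ = runs G Gs union ω in b , eval G p , run , correct G isDiameter)
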